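{- Let $G=x_0^4+x_1^4+x_2^4+x_3^4$ and $H=x_4^4+x_5^4+x_6^4+x_7^4+x_8^4+x_9^4$. If $K=\mathbb{Q}_2(\sqrt{2})$ with $\pi=\sqrt2$, or $K=\mathbb{Q}_2(\sqrt{10})$ with $\pi=\sqrt{10}$, then $F=G+\pi H$ has no nontrivial zero in $K^{10}$. If $K=\mathbb{Q}_2(\sqrt{ -2})$ with $\pi=\sqrt{ -2}$, or $K=\mathbb{Q}_2(\sqrt{ -10})$ with $\pi=\sqrt{ -10}$, then $F=G+(\pi+\pi^2)H$ has no nontrivial zero in $K^{10}$.
   Context: In each case $\pi$ is a uniformizer of the ring of integers of $K$. A nontrivial zero is a zero other than the all-zero vector. -}

module Defs where

open import Algebra.Bundles using (RawRing)
import Algebra.Definitions.RawSemiring as RawSemiringDefs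
open import Data.Fin using (Fin; #_)
open import Data.Integer using (ℤ; +_; 0ℤ; 1ℤ)
  renaming (_+_ to _+ᶻ_; _*_ to _*ᶻ_; _-_ to _-ᶻ_; -_ to -ᶻ_)
open import Data.Integer.Divisibility.Signed
  using (_∣_; divides; ∣m∣n⇒∣m+n; ∣m⇒∣-m; ∣n⇒∣m*n)
open import Data.Integer.Properties using (*-zeroˡ; +-inverseʳ)
open import Data.Integer.Tactic.RingSolver using (solve-∀)
open import Data.Nat using (ℕ; suc) renaming (_+_ to _+ⁿ_; _^_ to _^ⁿ_)
open import Data.Product using (_×_; ∃-syntax)
open import Data.Vec.Functional using (Vector)
open import Level using (0ℓ)
open import Relation.Binary.PropositionalEquality using (_≡_; sym; trans; subst)
open import Relation.Nullary using (¬_)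

infix 4 _≡_mod2^_

_≡_mod2^_ : ℤ → ℤ → ℕ → Set
a ≡ b mod2^ n = + (2 ^ⁿ n) ∣ a -ᶻ b

mod-refl : ∀ a n → a ≡ a mod2^ n
mod-refl a n = divides 0ℤ (trans (+-inverseʳ a) (sym (*-zeroˡ (+ (2 ^ⁿ n)))))

mod-+ : ∀ a b c d n → a ≡ b mod2^ n → c ≡ d mod2^ n → a +ᶻ c ≡ b +ᶻ d mod2^ n
mod-+ a b c d n p q = subst (+ (2 ^ⁿ n) ∣_) (lemma a b c d) (∣m∣n⇒∣m+n p q)
  where
  lemma : ∀ a b c d → (a -ᶻ b) +ᶻ (c -ᶻ d) ≡ (a +ᶻ c) -ᶻ (b +ᶻ d)
  lemma = solve-∀

mod-* : ∀ a b c d n → a ≡ b mod2^ n → c ≡ d mod2^ n → a *ᶻ c ≡ b *ᶻ d mod2^ n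
mod-* a b c d n p q =
  subst (+ (2 ^ⁿ n) ∣_) (lemma a b c d) (∣m∣n⇒∣m+n (∣n⇒∣m*n c p) (∣n⇒∣m*n b q))
  where
  lemma : ∀ a b c d → c *ᶻ (a -ᶻ b) +ᶻ b *ᶻ (c -ᶻ d) ≡ a *ᶻ c -ᶻ b *ᶻ d
  lemma = solve-∀

mod-neg : ∀ a b n → a ≡ b mod2^ n → -ᶻ a ≡ -ᶻ b mod2^ n
mod-neg a b n p = subst (+ (2 ^ⁿ n) ∣_) (lemma a b) (∣m⇒∣-m p)
  where
  lemma : ∀ a b → -ᶻ (a -ᶻ b) ≡ (-ᶻ a) -ᶻ (-ᶻ b)
  lemma = solve-∀

-- ℤ₂ is the inverse limit of the rings ℤ/2ⁿ; `approx n` is an integer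
-- representing the component in ℤ/2ⁿ.
record ℤ₂ : Set where
  constructor mkℤ₂
  field
    approx   : ℕ → ℤ
    coherent : ∀ n → approx (suc n) ≡ approx n mod2^ n
open ℤ₂ public

ℤ₂-fromℤ : ℤ → ℤ₂
ℤ₂-fromℤ a = mkℤ₂ (λ _ → a) (mod-refl a)

ℤ₂-rawRing : RawRing 0ℓ 0ℓ
ℤ₂-rawRing = record
  { Carrier = ℤ₂
  ; _≈_ = λ a b → ∀ n → approx a n ≡ approx b n mod2^ n
  ; _+_ = λ a b → mkℤ₂ (λ n → approx a n +ᶻ approx b n)
      (λ n → mod-+ (approx a (suc n)) (approx a n) (approx b (suc n)) (approx b n) n
                   (coherent a n) (coherent b n))
  ; _*_ = λ a b → mkℤ₂ (λ n → approx a n *ᶻ approx b n)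
      (λ n → mod-* (approx a (suc n)) (approx a n) (approx b (suc n)) (approx b n) n
                   (coherent a n) (coherent b n))
  ; -_ = λ a → mkℤ₂ (λ n → -ᶻ approx a n)
      (λ n → mod-neg (approx a (suc n)) (approx a n) n (coherent a n))
  ; 0# = ℤ₂-fromℤ 0ℤ
  ; 1# = ℤ₂-fromℤ 1ℤ
  }

-- ℚ₂ = ℤ₂[1/2], the fraction field of ℤ₂: `num /2^ exp` stands for num / 2^exp.
record ℚ₂ : Set where
  constructor _/2^_
  field
    num : ℤ₂
    exp : ℕ
open ℚ₂ public

ℚ₂-rawRing : RawRing 0ℓ 0ℓ
ℚ₂-rawRing = record
  { Carrier = ℚ₂
  ; _≈_ = λ x y → (num x * 2^ exp y) ≈ (num y * 2^ exp x)
  ; _+_ = λ x y → ((num x * 2^ exp y) + (num y * 2^ exp x)) /2^ (exp x +ⁿ exp y)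
  ; _*_ = λ x y → (num x * num y) /2^ (exp x +ⁿ exp y)
  ; -_ = λ x → (- num x) /2^ exp x
  ; 0# = 0# /2^ 0
  ; 1# = 1# /2^ 0
  }
  where
  open RawRing ℤ₂-rawRing
  2^_ : ℕ → ℤ₂
  2^ k = ℤ₂-fromℤ (+ (2 ^ⁿ k))

ℚ₂-fromℤ : ℤ → ℚ₂
ℚ₂-fromℤ a = ℤ₂-fromℤ a /2^ 0

-- ℚ₂(√d) = ℚ₂[t]/(t² − d), with `a +√ b` standing for a + b√d.  This is the
-- field ℚ₂(√d) when d is not a square in ℚ₂, as is the case for every integer d
-- of odd 2-adic valuation.
record ℚ₂⟨√_⟩ (d : ℤ) : Set where
  constructor _+√_
  field
    rat  : ℚ₂
    surd : ℚ₂
open ℚ₂⟨√_⟩ public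

√ : (d : ℤ) → ℚ₂⟨√ d ⟩
√ d = 0# +√ 1#
  where open RawRing ℚ₂-rawRing

ℚ₂⟨√_⟩-rawRing : ℤ → RawRing 0ℓ 0ℓ
ℚ₂⟨√ d ⟩-rawRing = record
  { Carrier = ℚ₂⟨√ d ⟩
  ; _≈_ = λ x y → (rat x ≈ rat y) × (surd x ≈ surd y)
  ; _+_ = λ x y → (rat x + rat y) +√ (surd x + surd y)
  ; _*_ = λ x y → ((rat x * rat y) + (ℚ₂-fromℤ d * (surd x * surd y)))
                  +√ ((rat x * surd y) + (surd x * rat y))
  ; -_ = λ x → (- rat x) +√ (- surd x)
  ; 0# = 0# +√ 0#
  ; 1# = 1# +√ 0#
  }
  where open RawRing ℚ₂-rawRing

module Forms (K : RawRing 0ℓ 0ℓ) where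
  open RawRing K
  open RawSemiringDefs rawSemiring using (_^_)

  G : Vector Carrier 10 → Carrier
  G x = x (# 0) ^ 4 + x (# 1) ^ 4 + x (# 2) ^ 4 + x (# 3) ^ 4

  H : Vector Carrier 10 → Carrier
  H x = x (# 4) ^ 4 + x (# 5) ^ 4 + x (# 6) ^ 4 + x (# 7) ^ 4 + x (# 8) ^ 4 + x (# 9) ^ 4

  G+_·H : Carrier → Vector Carrier 10 → Carrier
  G+ c ·H = λ x → G x + c * H x

  NontrivialZero : ∀ {n} → (Vector Carrier n → Carrier) → Vector Carrier n → Set
  NontrivialZero F x = (F x ≈ 0#) × ¬ (∀ i → x i ≈ 0#)

  HasNoNontrivialZero : ∀ {n} → (Vector Carrier n → Carrier) → Set
  HasNoNontrivialZero F = ¬ (∃[ x ] NontrivialZero F x)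

-- The forms G + πH and G + (π + π²)H over K = ℚ₂(√d), with π = √d.
module _ (d : ℤ) where
  open RawRing ℚ₂⟨√ d ⟩-rawRing using (Carrier; _+_; rawSemiring)
  open RawSemiringDefs rawSemiring using (_^_)
  open Forms ℚ₂⟨√ d ⟩-rawRing

  G+πH : Vector Carrier 10 → Carrier
  G+πH = G+ √ d ·H

  G+[π+π²]H : Vector Carrier 10 → Carrier
  G+[π+π²]H = G+ √ d + √ d ^ 2 ·H

NoNontrivialZeroOver : (d : ℤ) → (Vector ℚ₂⟨√ d ⟩ 10 → ℚ₂⟨√ d ⟩) → Set
NoNontrivialZeroOver d = Forms.HasNoNontrivialZero ℚ₂⟨√ d ⟩-rawRing

{-# OPTIONS --safe #-}
module Submission where

-- Write d = 2e with e odd and F = G + (εd + √d) H, where ε = 0 or 1.  In all four cases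
-- e ≡ 1 + 2ε (mod 4), and this is exactly what makes the following work.  For
-- z = a + b√d let z⁴ = p + q√d.  Then 4 ∣ q, and p + εdq is congruent modulo 16 to 1 if a
-- is odd, to 4 if only b is odd, and to 0 otherwise.  If F(z) ≡ 0 (mod 16), the √d-component
-- gives 4 ∣ ΣH p; so the rational component gives 8 ∣ ΣG p, which four terms 0, 1, 4 only
-- allow when no term is 1.  Now 16 ∣ q in G, so that the √d-component becomes
-- 16 ∣ ΣH (p + εdq), which six terms 0, 1, 4 again only allow when no term is 1.
-- Hence every z is divisible by √d.  Dividing by √d and repeating the argument shows
-- that every z is divisible by 2 as soon as F(z) ≡ 0 (mod 64), and infinite descent
-- makes a zero divisible by all powers of 2.

open import Defs
open import Algebra.Bundles using (RawRing)
import Algebra.Definitions.RawSemiring as RawSemiringDefs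
open import Data.Fin using (Fin; zero; suc; #_; _↑ˡ_; _↑ʳ_; splitAt; join)
open import Data.Fin.Properties using (join-splitAt)
open import Data.Integer using (ℤ; +_; -_; _+_; _*_; _-_; _^_; 0ℤ; 1ℤ; NonZero)
open import Data.Integer.Divisibility.Signed
open import Data.Integer.DivMod using (_%_; _/_; n%d<d; a≡a%n+[a/n]*n)
open import Data.Integer.Properties as ℤ
open import Data.Integer.Properties using (+-*-semiring; pos-+; pos-*)
open import Data.Integer.Tactic.RingSolver using (solve-∀)
open import Data.Nat as ℕ using (ℕ; zero; suc; s≤s; z≤n)
import Data.Nat.Properties as ℕ
open import Data.Nat.Tactic.RingSolver using () renaming (solve-∀ to solveℕ-∀)
open import Data.Product using (_×_; _,_; ∃-syntax; proj₁; proj₂)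
open import Data.Sum using (_⊎_; inj₁; inj₂)
open import Data.Vec.Functional using (Vector)
open import Function using (_∘_)
open import Level using (0ℓ)
open import Relation.Binary.PropositionalEquality
open import Relation.Nullary.Decidable using (_→-dec_; from-yes)

open import Algebra.Properties.Semiring.Sum +-*-semiring
  using (sum; sum-cong-≗; *-distribˡ-sum; ∑-distrib-+)

-- Parity and odd fourth powers modulo 16.

parity : ∀ a → (∃[ s ] a ≡ + 2 * s) ⊎ (∃[ s ] a ≡ 1ℤ + + 2 * s)
parity a with a % + 2 | n%d<d a (+ 2) | a≡a%n+[a/n]*n a (+ 2)
... | 0 | _ | eq = inj₁ (a / + 2 , trans eq (lemma (a / + 2)))
  where
  lemma : ∀ q → 0ℤ + q * + 2 ≡ + 2 * q
  lemma = solve-∀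
... | 1 | _ | eq = inj₂ (a / + 2 , trans eq (lemma (a / + 2)))
  where
  lemma : ∀ q → 1ℤ + q * + 2 ≡ 1ℤ + + 2 * q
  lemma = solve-∀
... | suc (suc _) | s≤s (s≤s ()) | _

-- For a = 1 + 2s, a⁴ - 1 = 8(s + 3s²) + 16(2s³ + s⁴), and s + 3s² is even. Splitting on the parity
-- of s turns the quotient by 16 into a polynomial with integer coefficients.
16∣odd⁴-1 : ∀ s → let a = 1ℤ + + 2 * s in + 16 ∣ a * a * (a * a) - 1ℤ
16∣odd⁴-1 s with parity s
... | inj₁ (r , refl) =
  divides (r + + 6 * (r * r) + + 16 * (r * r * r) + + 16 * (r * r * r * r)) (lemma r)
  where
  lemma : ∀ r → let a = 1ℤ + + 2 * (+ 2 * r) in a * a * (a * a) - 1ℤ ≡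
    (r + + 6 * (r * r) + + 16 * (r * r * r) + + 16 * (r * r * r * r)) * + 16
  lemma = solve-∀
... | inj₂ (r , refl) =
  divides (+ 5 + + 27 * r + + 54 * (r * r) + + 48 * (r * r * r) + + 16 * (r * r * r * r)) (lemma r)
  where
  lemma : ∀ r → let a = 1ℤ + + 2 * (1ℤ + + 2 * r) in a * a * (a * a) - 1ℤ ≡
    (+ 5 + + 27 * r + + 54 * (r * r) + + 48 * (r * r * r) + + 16 * (r * r * r * r)) * + 16
  lemma = solve-∀

-- Sums over the two blocks of variables.

∣-sum : ∀ {m n} (f : Vector ℤ n) → (∀ i → m ∣ f i) → m ∣ sum f
∣-sum {n = zero}  f m∣f = divides 0ℤ refl
∣-sum {n = suc n} f m∣f = ∣m∣n⇒∣m+n (m∣f zero) (∣-sum (f ∘ suc) (m∣f ∘ suc))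

sum-proportional : ∀ {n} x y (f g : Vector ℤ n) → (∀ i → x * f i ≡ y * g i) → x * sum f ≡ y * sum g
sum-proportional x y f g xf≡yg =
  trans (*-distribˡ-sum x f) (trans (sum-cong-≗ xf≡yg) (sym (*-distribˡ-sum y g)))

ιG : Fin 4 → Fin 10
ιG i = i ↑ˡ 6
ιH : Fin 6 → Fin 10
ιH j = 4 ↑ʳ j

ΣG ΣH : Vector ℤ 10 → ℤ
ΣG f = sum (f ∘ ιG)
ΣH f = sum (f ∘ ιH)

-- (a + b√d)⁴ = re⁴ d a b + im⁴ d a b √d
re⁴ im⁴ : ℤ → ℤ → ℤ → ℤ
re⁴ d a b = a * a * (a * a) + + 6 * d * (a * a) * (b * b) + d * d * (b * b * (b * b))
im⁴ d a b = + 4 * (a * b * (a * a + d * (b * b)))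

-- Sums of residues 0, 1 and 4.

-- s is, modulo 2ⁿ, a sum of at most m terms: u terms 1 and v terms 4, the others being 0.
Weighted : ℕ → ℕ → Set → ℤ → Set
Weighted m n E s =
  ∃[ u ] ∃[ v ] (u ℕ.+ v ℕ.≤ m) × (s ≡ + u + + 4 * + v mod2^ n) × (u ≡ 0 → E)

Weighted-+ : ∀ {m m′ n E E′ s s′} → Weighted m n E s → Weighted m′ n E′ s′ →
  Weighted (m ℕ.+ m′) n (E × E′) (s + s′)
Weighted-+ {m} {m′} {n} {s = s} {s′} (u , v , u+v≤m , s≡ , e) (u′ , v′ , u′+v′≤m′ , s′≡ , e′) =
  u ℕ.+ u′ , v ℕ.+ v′
  , subst (ℕ._≤ m ℕ.+ m′) (interchange u v u′ v′) (ℕ.+-mono-≤ u+v≤m u′+v′≤m′)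
  , subst (s + s′ ≡_mod2^ n) weights (mod-+ s (+ u + + 4 * + v) s′ (+ u′ + + 4 * + v′) n s≡ s′≡)
  , λ u+u′≡0 → e (ℕ.m+n≡0⇒m≡0 u u+u′≡0) , e′ (ℕ.m+n≡0⇒n≡0 u u+u′≡0)
  where
  interchange : ∀ a b c d → (a ℕ.+ b) ℕ.+ (c ℕ.+ d) ≡ (a ℕ.+ c) ℕ.+ (b ℕ.+ d)
  interchange = solveℕ-∀
  lemma : ∀ a b c d → (a + + 4 * b) + (c + + 4 * d) ≡ (a + c) + + 4 * (b + d)
  lemma = solve-∀
  weights : (+ u + + 4 * + v) + (+ u′ + + 4 * + v′) ≡ + (u ℕ.+ u′) + + 4 * + (v ℕ.+ v′)
  weights rewrite pos-+ u u′ | pos-+ v v′ = lemma (+ u) (+ v) (+ u′) (+ v′)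

Weighted-sum : ∀ {m n} {E : Fin m → Set} (f : Vector ℤ m) →
  (∀ i → Weighted 1 n (E i) (f i)) → Weighted m n (∀ i → E i) (sum f)
Weighted-sum {zero} {n} f w = 0 , 0 , z≤n , mod-refl 0ℤ n , λ _ ()
Weighted-sum {suc m} {n} f w =
  let u , v , ≤m , ≡w , e = Weighted-+ {n = n} {s = f zero} {s′ = sum (f ∘ suc)}
                              (w zero) (Weighted-sum {n = n} (f ∘ suc) (w ∘ suc))
  in  u , v , ≤m , ≡w , λ u≡0 → λ { zero → proj₁ (e u≡0) ; (suc i) → proj₂ (e u≡0) i }

-- Needed for G, where the residues are known modulo 16 for p + εdq but are used modulo 8 for p
-- alone.
Weighted-coarsen : ∀ {m E s t n n′} → + (2 ℕ.^ n′) ∣ + (2 ℕ.^ n) → s ≡ t mod2^ n′ →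
  Weighted m n E t → Weighted m n′ E s
Weighted-coarsen {s = s} {t} 2^n′∣2^n s≡t (u , v , ≤m , t≡ , e) =
  u , v , ≤m , subst (_ ∣_) (lemma s t (+ u + + 4 * + v)) (∣m∣n⇒∣m+n s≡t (∣-trans 2^n′∣2^n t≡)) , e
  where
  lemma : ∀ s t w → (s - t) + (t - w) ≡ s - w
  lemma = solve-∀

-- The separate bounds on `u` and `v` follow from the bound on their sum. They are in the form that
-- `allUpTo?` decides, so that each instance is a finite check.
NoUnits : ℕ → ℕ → Set
NoUnits m n = ∀ {u} → u ℕ.< suc m → ∀ {v} → v ℕ.< suc m →
  u ℕ.+ v ℕ.≤ m → + (2 ℕ.^ n) ∣ + u + + 4 * + v → u ≡ 0

-- Divisibility by 4 leaves only u = 4 besides u = 0; then v = 0, and 8 does not divide 4.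
noUnits-4-3 : NoUnits 4 3
noUnits-4-3 = from-yes (ℕ.allUpTo? (λ u → ℕ.allUpTo? (λ v →
  (u ℕ.+ v ℕ.≤? 4) →-dec (+ 8 ∣? + u + + 4 * + v) →-dec (u ℕ.≟ 0)) 5) 5)

-- Again u = 4 is the only rival of u = 0; then v ≤ 2, and 4 + 4v is positive and at most 12.
noUnits-6-4 : NoUnits 6 4
noUnits-6-4 = from-yes (ℕ.allUpTo? (λ u → ℕ.allUpTo? (λ v →
  (u ℕ.+ v ℕ.≤? 6) →-dec (+ 16 ∣? + u + + 4 * + v) →-dec (u ℕ.≟ 0)) 7) 7)

-- The divisibility passes from s to u + 4v, so that `noUnits` gives u = 0. `E` collects what the
-- absence of terms 1 implies, in the applications that all rational parts are even.
Weighted-zero : ∀ {m n E s} → NoUnits m n → Weighted m n E s → + (2 ℕ.^ n) ∣ s → E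
Weighted-zero {m} {n} {s = s} noUnits (u , v , u+v≤m , s≡ , e) 2^n∣s =
  e (noUnits (s≤s (ℕ.m+n≤o⇒m≤o u u+v≤m)) (s≤s (ℕ.m+n≤o⇒n≤o u u+v≤m)) u+v≤m
    (subst (_ ∣_) (lemma s (+ u + + 4 * + v)) (∣m∣n⇒∣m-n 2^n∣s s≡)))
  where
  lemma : ∀ s w → s - (s - w) ≡ w
  lemma = solve-∀

-- Congruences and descent for integer vectors.

module Anisotropic (ε k : ℤ) where

  e d : ℤ
  e = 1ℤ + + 2 * ε + + 4 * k
  d = + 2 * e

  -- d is even and 4 divides `im⁴`. Hence p and p + εdq agree modulo 8, which suffices for the four
  -- terms of G.
  8∣ε*d*im⁴ : ∀ a b → + 8 ∣ ε * d * im⁴ d a b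
  8∣ε*d*im⁴ a b = divides (ε * e * (a * b * (a * a + d * (b * b))))
    (lemma e ε (a * b * (a * a + d * (b * b))))
    where
    lemma : ∀ e ε x → ε * (+ 2 * e) * (+ 4 * x) ≡ ε * e * x * + 8
    lemma = solve-∀

  -- The mixed terms 12e a²b² and 8εe ab(a² + db²) vanish modulo 16 once a or b is even, leaving a⁴
  -- + 4e²b⁴ with e odd. If both are odd, the mixed terms and d²b⁴ must cancel modulo 16, and this
  -- is where the relation between e and ε enters.
  weight : ∀ a b → Weighted 1 4 (+ 2 ∣ a) (re⁴ d a b + ε * d * im⁴ d a b)
  weight a b with parity a | parity b
  ... | inj₁ (s , refl) | inj₁ (t , refl) =
    0 , 0 , z≤n , divides (re⁴ d s t + ε * d * im⁴ d s t) (lemma s t ε d) , λ _ → divides s (2*s s)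
    where
    2*s : ∀ s → + 2 * s ≡ s * + 2
    2*s = solve-∀
    lemma : ∀ s t ε d → let a = + 2 * s ; b = + 2 * t in
      (a * a * (a * a) + + 6 * d * (a * a) * (b * b) + d * d * (b * b * (b * b)))
        + ε * d * (+ 4 * (a * b * (a * a + d * (b * b)))) - 0ℤ ≡
      ((s * s * (s * s) + + 6 * d * (s * s) * (t * t) + d * d * (t * t * (t * t)))
        + ε * d * (+ 4 * (s * t * (s * s + d * (t * t))))) * + 16
    lemma = solve-∀
  ... | inj₁ (s , refl) | inj₂ (t , refl) =
    0 , 1 , s≤s z≤n , divides q (lemma s t ε k) , λ _ → divides s (2*s s)
    where
    2*s : ∀ s → + 2 * s ≡ s * + 2
    2*s = solve-∀
    -- Here e b² = 1 + 2y, so that d²b⁴ - 4 = 4((1 + 2y)² - 1) = 16(y + y²).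
    q : ℤ
    q = let b = 1ℤ + + 2 * t ; f = ε + + 2 * k
            y = f + e * (+ 2 * t + + 2 * (t * t)) in
      s * s * (s * s) + + 3 * (s * s) * (e * (b * b)) + y + y * y
        + ε * (e * s * b * (+ 4 * (s * s) + d * (b * b)))
    lemma : ∀ s t ε k →
      let a = + 2 * s ; b = 1ℤ + + 2 * t ; f = ε + + 2 * k
          e = 1ℤ + + 2 * ε + + 4 * k ; d = + 2 * e
          y = f + e * (+ 2 * t + + 2 * (t * t)) in
      (a * a * (a * a) + + 6 * d * (a * a) * (b * b) + d * d * (b * b * (b * b)))
        + ε * d * (+ 4 * (a * b * (a * a + d * (b * b)))) - + 4 ≡
      (s * s * (s * s) + + 3 * (s * s) * (e * (b * b)) + y + y * y
        + ε * (e * s * b * (+ 4 * (s * s) + d * (b * b)))) * + 16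
    lemma = solve-∀
  ... | inj₂ (s , refl) | inj₁ (t , refl) =
    1 , 0 , s≤s z≤n ,
    subst (+ 16 ∣_) (sym (lemma (1ℤ + + 2 * s) t ε e))
      (∣m∣n⇒∣m+n (16∣odd⁴-1 s) (divides q refl)) , λ ()
    where
    q : ℤ
    q = let a = 1ℤ + + 2 * s in
      + 3 * e * (a * a) * (t * t) + + 4 * (e * e) * (t * t * (t * t))
        + ε * e * a * t * (a * a + + 8 * e * (t * t))
    lemma : ∀ a t ε e → let b = + 2 * t ; d = + 2 * e in
      (a * a * (a * a) + + 6 * d * (a * a) * (b * b) + d * d * (b * b * (b * b)))
        + ε * d * (+ 4 * (a * b * (a * a + d * (b * b)))) - 1ℤ ≡
      (a * a * (a * a) - 1ℤ) + (+ 3 * e * (a * a) * (t * t) + + 4 * (e * e) * (t * t * (t * t))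
        + ε * e * a * t * (a * a + + 8 * e * (t * t))) * + 16
    lemma = solve-∀
  ... | inj₂ (s , refl) | inj₂ (t , refl) =
    1 , 0 , s≤s z≤n ,
    subst (+ 16 ∣_) (sym (lemma s t ε k))
      (∣m∣n⇒∣m+n (16∣odd⁴-1 s) (divides q refl)) , λ ()
    where
    -- With a² = 1 + 4σ, b² = 1 + 4τ and ab = 1 + 2ρ, the part not visibly divisible by 16 is 12e +
    -- 4e² + 8εe = 4e(3 + e + 2ε). Since e = 1 + 2ε + 4k, it equals 16e(1 + ε + k).
    q : ℤ
    q = let A = (1ℤ + + 2 * s) * (1ℤ + + 2 * s) ; B = (1ℤ + + 2 * t) * (1ℤ + + 2 * t)
            σ = s + s * s ; τ = t + t * t ; ρ = s + t + + 2 * (s * t) in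
      e * (1ℤ + ε + k + + 3 * (σ + τ + + 4 * (σ * τ)) + e * (+ 2 * τ + + 4 * (τ * τ))
        + + 2 * (ε * σ) + ε * e * B + ε * ρ * (A + + 2 * e * B))
    lemma : ∀ s t ε k →
      let a = 1ℤ + + 2 * s ; b = 1ℤ + + 2 * t
          e = 1ℤ + + 2 * ε + + 4 * k ; d = + 2 * e
          A = a * a ; B = b * b
          σ = s + s * s ; τ = t + t * t ; ρ = s + t + + 2 * (s * t) in
      (a * a * (a * a) + + 6 * d * (a * a) * (b * b) + d * d * (b * b * (b * b)))
        + ε * d * (+ 4 * (a * b * (a * a + d * (b * b)))) - 1ℤ ≡
      (a * a * (a * a) - 1ℤ)
        + e * (1ℤ + ε + k + + 3 * (σ + τ + + 4 * (σ * τ)) + e * (+ 2 * τ + + 4 * (τ * τ))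
          + + 2 * (ε * σ) + ε * e * B + ε * ρ * (A + + 2 * e * B)) * + 16
    lemma = solve-∀

  -- The components of ΣG z + (εd + √d) ΣH z for a vector z = p + q√d.
  reF imF : Vector ℤ 10 → Vector ℤ 10 → ℤ
  reF p q = ΣG p + (ε * d * ΣH p + d * ΣH q)
  imF p q = ΣG q + (ε * d * ΣH q + 1ℤ * ΣH p)

  re⁴ⱽ im⁴ⱽ : Vector ℤ 10 → Vector ℤ 10 → Vector ℤ 10
  re⁴ⱽ a b i = re⁴ d (a i) (b i)
  im⁴ⱽ a b i = im⁴ d (a i) (b i)

  record ZeroMod (m : ℤ) (a b : Vector ℤ 10) : Set where
    constructor _,_
    field
      re∣ : m ∣ reF (re⁴ⱽ a b) (im⁴ⱽ a b)
      im∣ : m ∣ imF (re⁴ⱽ a b) (im⁴ⱽ a b)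

  ZeroMod-coarsen : ∀ {m n a b} → m ∣ n → ZeroMod n a b → ZeroMod m a b
  ZeroMod-coarsen m∣n (n∣re , n∣im) = ∣-trans m∣n n∣re , ∣-trans m∣n n∣im

  -- Both components of F are linear in the components of the fourth powers, so a common factor y/x
  -- of the latter is inherited by F. The modulus loses the factor x when x is cancelled.
  ZeroMod-proportional : ∀ x y {m a b a′ b′} .{{_ : NonZero x}} →
    (∀ i → x * re⁴ d (a i) (b i) ≡ y * re⁴ d (a′ i) (b′ i)) →
    (∀ i → x * im⁴ d (a i) (b i) ≡ y * im⁴ d (a′ i) (b′ i)) →
    ZeroMod (x * m) a′ b′ → ZeroMod m a b
  ZeroMod-proportional x y {m} {a} {b} {a′} {b′} re-eq im-eq (xm∣re , xm∣im) =
      *-cancelˡ-∣ x {m} {reF p q} (subst (x * m ∣_) (sym (combine x y (ε * d) d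
        (ΣG p) (ΣH p) (ΣH q) (ΣG p′) (ΣH p′) (ΣH q′)
        (proportional p p′ ιG re-eq) (proportional p p′ ιH re-eq)
        (proportional q q′ ιH im-eq)))
        (∣n⇒∣m*n y {reF p′ q′} xm∣re))
    , *-cancelˡ-∣ x {m} {imF p q} (subst (x * m ∣_) (sym (combine x y (ε * d) 1ℤ
        (ΣG q) (ΣH q) (ΣH p) (ΣG q′) (ΣH q′) (ΣH p′)
        (proportional q q′ ιG im-eq) (proportional q q′ ιH im-eq)
        (proportional p p′ ιH re-eq)))
        (∣n⇒∣m*n y {imF p′ q′} xm∣im))
    where
    p q p′ q′ : Vector ℤ 10
    p = re⁴ⱽ a b
    q = im⁴ⱽ a b
    p′ = re⁴ⱽ a′ b′
    q′ = im⁴ⱽ a′ b′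
    proportional : ∀ {n} (f g : Vector ℤ 10) (ι : Fin n → Fin 10) →
      (∀ i → x * f i ≡ y * g i) → x * sum (f ∘ ι) ≡ y * sum (g ∘ ι)
    proportional f g ι eq = sum-proportional x y (f ∘ ι) (g ∘ ι) (eq ∘ ι)
    -- One identity serves both components: (u, v) is (εd, d) for the rational one and (εd, 1) for
    -- the other.
    combine : ∀ x y u v s t r s′ t′ r′ → x * s ≡ y * s′ → x * t ≡ y * t′ → x * r ≡ y * r′ →
      x * (s + (u * t + v * r)) ≡ y * (s′ + (u * t′ + v * r′))
    combine x y u v s t r s′ t′ r′ ps pt pr = begin
      x * (s + (u * t + v * r))                  ≡⟨ expand x s u t v r ⟩
      x * s + (u * (x * t) + v * (x * r))        ≡⟨ cong₂ _+_ ps (cong₂ (λ A B → u * A + v * B) pt pr) ⟩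
      y * s′ + (u * (y * t′) + v * (y * r′))     ≡⟨ expand y s′ u t′ v r′ ⟨
      y * (s′ + (u * t′ + v * r′))               ∎
      where
      open ≡-Reasoning
      expand : ∀ x s u t v r → x * (s + (u * t + v * r)) ≡ x * s + (u * (x * t) + v * (x * r))
      expand = solve-∀

  4∣im⁴ : ∀ a b → + 4 ∣ im⁴ d a b
  4∣im⁴ a b = ∣m⇒∣m*n (a * b * (a * a + d * (b * b))) ∣-refl

  -- Besides 4 and a, the factor a² + db² is even too, because d is.
  16∣im⁴ : ∀ {a} b → + 2 ∣ a → + 16 ∣ im⁴ d a b
  16∣im⁴ b (divides s refl) = divides (s * b * (+ 2 * (s * s) + e * (b * b))) (lemma s b e)
    where
    lemma : ∀ s b e → let a = s * + 2 in
      + 4 * (a * b * (a * a + + 2 * e * (b * b))) ≡ s * b * (+ 2 * (s * s) + e * (b * b)) * + 16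
    lemma = solve-∀

  8∣d* : ∀ {x} → + 4 ∣ x → + 8 ∣ d * x
  8∣d* (divides q refl) = divides (e * q) (lemma e q)
    where
    lemma : ∀ e q → + 2 * e * (q * + 4) ≡ e * q * + 8
    lemma = solve-∀

  Fin10-elim : ∀ {P : Fin 10 → Set} → (∀ i → P (ιG i)) → (∀ j → P (ιH j)) → ∀ i → P i
  Fin10-elim {P} l r i = subst P (join-splitAt 4 6 i) (on-join (splitAt 4 i))
    where
    on-join : ∀ s → P (join 4 6 s)
    on-join (inj₁ i) = l i
    on-join (inj₂ j) = r j

  2∣re : ∀ a b → ZeroMod (+ 16) a b → ∀ i → + 2 ∣ a i
  2∣re a b (16∣reF , 16∣imF-1*) = Fin10-elim 2∣G 2∣H
    where
    p q : Vector ℤ 10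
    p = re⁴ⱽ a b
    q = im⁴ⱽ a b
    4∣16 : + 4 ∣ + 16
    4∣16 = divides (+ 4) refl
    8∣16 : + 8 ∣ + 16
    8∣16 = divides (+ 2) refl
    16∣imF : + 16 ∣ ΣG q + (ε * d * ΣH q + ΣH p)
    16∣imF = subst (λ x → + 16 ∣ ΣG q + (ε * d * ΣH q + x)) (ℤ.*-identityˡ (ΣH p)) 16∣imF-1*
    4∣imF : + 4 ∣ ΣG q + (ε * d * ΣH q + ΣH p)
    4∣imF = ∣-trans 4∣16 16∣imF
    8∣reF : + 8 ∣ reF p q
    8∣reF = ∣-trans 8∣16 16∣reF
    4∣Σq : ∀ {n} (ι : Fin n → Fin 10) → + 4 ∣ sum (q ∘ ι)
    4∣Σq ι = ∣-sum (q ∘ ι) (λ i → 4∣im⁴ (a (ι i)) (b (ι i)))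
    4∣ΣHp : + 4 ∣ ΣH p
    4∣ΣHp = ∣m+n∣m⇒∣n {m = ε * d * ΣH q}
      (∣m+n∣m⇒∣n {m = ΣG q} {ε * d * ΣH q + ΣH p} 4∣imF (4∣Σq ιG))
      (∣n⇒∣m*n (ε * d) {ΣH q} (4∣Σq ιH))
    8∣ΣGp : + 8 ∣ ΣG p
    8∣ΣGp = ∣m+n∣n⇒∣m {m = ΣG p} {ε * d * ΣH p + d * ΣH q} 8∣reF
      (∣m∣n⇒∣m+n {m = ε * d * ΣH p} {d * ΣH q}
        (subst (+ 8 ∣_) (sym (ℤ.*-assoc ε d (ΣH p))) (∣n⇒∣m*n ε {d * ΣH p} (8∣d* {ΣH p} 4∣ΣHp)))
        (8∣d* {ΣH q} (4∣Σq ιH)))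
    2∣G : ∀ i → + 2 ∣ a (ιG i)
    2∣G = Weighted-zero {n = 3} noUnits-4-3 (Weighted-sum {n = 3} (p ∘ ιG) weight₃) 8∣ΣGp
      where
      weight₃ : ∀ i → Weighted 1 3 (+ 2 ∣ a (ιG i)) (p (ιG i))
      weight₃ i = Weighted-coarsen {s = p (ιG i)} {t = p (ιG i) + ε * d * q (ιG i)} {n = 4} {n′ = 3} 8∣16
        (subst (+ 8 ∣_) (lemma (p (ιG i)) (ε * d * q (ιG i)))
          (∣m⇒∣-m (8∣ε*d*im⁴ (a (ιG i)) (b (ιG i)))))
        (weight (a (ιG i)) (b (ιG i)))
        where
        lemma : ∀ s t → - t ≡ s - (s + t)
        lemma = solve-∀
    16∣ΣH : + 16 ∣ sum (λ j → p (ιH j) + ε * d * q (ιH j))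
    16∣ΣH = subst (+ 16 ∣_) ΣH-+
      (∣m+n∣m⇒∣n {m = ΣG q} {ε * d * ΣH q + ΣH p} 16∣imF (∣-sum {n = 4} (q ∘ ιG) (λ i → 16∣im⁴ (b (ιG i)) (2∣G i))))
      where
      ΣH-+ : ε * d * ΣH q + ΣH p ≡ sum (λ j → p (ιH j) + ε * d * q (ιH j))
      ΣH-+ = begin
        ε * d * ΣH q + ΣH p                            ≡⟨ ℤ.+-comm (ε * d * ΣH q) (ΣH p) ⟩
        ΣH p + ε * d * ΣH q                            ≡⟨ cong (λ x → ΣH p + x) (*-distribˡ-sum (ε * d) (q ∘ ιH)) ⟩
        ΣH p + ΣH (λ i → ε * d * q i)                  ≡⟨ ∑-distrib-+ (p ∘ ιH) (λ j → ε * d * q (ιH j)) ⟨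
        sum (λ j → p (ιH j) + ε * d * q (ιH j))    ∎
        where open ≡-Reasoning
    2∣H : ∀ j → + 2 ∣ a (ιH j)
    2∣H = Weighted-zero {n = 4} noUnits-6-4
      (Weighted-sum {n = 4} (λ j → p (ιH j) + ε * d * q (ιH j))
        (λ j → weight (a (ιH j)) (b (ιH j)))) 16∣ΣH

  -- For even a, √d (e b + (a/2) √d) = e (a + b√d), so that passing from a + b√d to
  -- e b + (a/2) √d amounts to division by √d up to the odd factor e.
  2∣im : ∀ a b → ZeroMod (+ 64) a b → ∀ i → + 2 ∣ b i
  -- The first result, applied to the vector divided by √d, makes e b even; as e is odd, b is even.
  2∣im a b F≡0 i = ∣m+n∣n⇒∣m {m = b i} {+ 2 * ((ε + + 2 * k) * b i)}
    (subst (+ 2 ∣_) (odd ε k (b i)) (2∣re eb a/2 F′≡0 i))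
    (∣m⇒∣m*n ((ε + + 2 * k) * b i) ∣-refl)
    where
    2∣a : ∀ i → + 2 ∣ a i
    2∣a = 2∣re a b (ZeroMod-coarsen (divides (+ 4) refl) F≡0)
    a/2 eb : Vector ℤ 10
    a/2 i = quotient (2∣a i)
    eb i = e * b i
    -- For z = a + b√d and z′ = e b + (a/2)√d, the fourth power of √d z′ = e z reads d² z′⁴ = e⁴ z⁴.
    -- As d² = 4e², this is 4 z′⁴ = e² z⁴, and the modulus drops from 64 to 16.
    re-step : ∀ e s b → let d = + 2 * e ; a = s * + 2 ; c = e * b in
      + 4 * (c * c * (c * c) + + 6 * d * (c * c) * (s * s) + d * d * (s * s * (s * s))) ≡
      e * e * (a * a * (a * a) + + 6 * d * (a * a) * (b * b) + d * d * (b * b * (b * b)))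
    re-step = solve-∀
    im-step : ∀ e s b → let d = + 2 * e ; a = s * + 2 ; c = e * b in
      + 4 * (+ 4 * (c * s * (c * c + d * (s * s)))) ≡
      e * e * (+ 4 * (a * b * (a * a + d * (b * b))))
    im-step = solve-∀
    F′≡0 : ZeroMod (+ 16) eb a/2
    F′≡0 = ZeroMod-proportional (+ 4) (e * e) 
      (λ i → trans (re-step e (a/2 i) (b i))
               (cong (λ x → e * e * re⁴ d x (b i)) (sym (_∣_.equality (2∣a i)))))
      (λ i → trans (im-step e (a/2 i) (b i))
               (cong (λ x → e * e * im⁴ d x (b i)) (sym (_∣_.equality (2∣a i)))))
      F≡0
    odd : ∀ ε k b → (1ℤ + + 2 * ε + + 4 * k) * b ≡ b + + 2 * ((ε + + 2 * k) * b)
    odd = solve-∀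

  -- Halving the vector divides F by 2⁴, and 64 = 4 · 16 is the modulus that permits one halving.
  -- Hence 4 · 16^j permits j of them.
  2^∣ : ∀ j a b → ZeroMod (+ 4 * (+ 16) ^ j) a b → ∀ i → ((+ 2) ^ j ∣ a i) × ((+ 2) ^ j ∣ b i)
  2^∣ zero    a b _   i = divides (a i) (sym (ℤ.*-identityʳ (a i))) , divides (b i) (sym (ℤ.*-identityʳ (b i)))
  2^∣ (suc j) a b F≡0 i = lift (2∣a i) (proj₁ ih) , lift (2∣b i) (proj₂ ih)
    where
    F≡0-64 : ZeroMod (+ 64) a b
    F≡0-64 = ZeroMod-coarsen (divides ((+ 16) ^ j) (lemma ((+ 16) ^ j))) F≡0
      where
      lemma : ∀ x → + 4 * (+ 16 * x) ≡ x * + 64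
      lemma = solve-∀
    2∣a : ∀ i → + 2 ∣ a i
    2∣a = 2∣re a b (ZeroMod-coarsen (divides (+ 4) refl) F≡0-64)
    2∣b : ∀ i → + 2 ∣ b i
    2∣b = 2∣im a b F≡0-64
    a/2 b/2 : Vector ℤ 10
    a/2 i = quotient (2∣a i)
    b/2 i = quotient (2∣b i)
    re-step : ∀ d s t → let a = s * + 2 ; b = t * + 2 in
      + 16 * (s * s * (s * s) + + 6 * d * (s * s) * (t * t) + d * d * (t * t * (t * t))) ≡
      1ℤ * (a * a * (a * a) + + 6 * d * (a * a) * (b * b) + d * d * (b * b * (b * b)))
    re-step = solve-∀
    im-step : ∀ d s t → let a = s * + 2 ; b = t * + 2 in
      + 16 * (+ 4 * (s * t * (s * s + d * (t * t)))) ≡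
      1ℤ * (+ 4 * (a * b * (a * a + d * (b * b))))
    im-step = solve-∀
    F′≡0 : ZeroMod (+ 4 * (+ 16) ^ j) a/2 b/2
    F′≡0 = ZeroMod-proportional (+ 16) 1ℤ 
      (λ i → trans (re-step d (a/2 i) (b/2 i))
               (cong₂ (λ x y → 1ℤ * re⁴ d x y) (sym (_∣_.equality (2∣a i))) (sym (_∣_.equality (2∣b i)))))
      (λ i → trans (im-step d (a/2 i) (b/2 i))
               (cong₂ (λ x y → 1ℤ * im⁴ d x y) (sym (_∣_.equality (2∣a i))) (sym (_∣_.equality (2∣b i)))))
      (ZeroMod-coarsen (divides 1ℤ (lemma ((+ 16) ^ j))) F≡0)
      where
      lemma : ∀ x → + 4 * (+ 16 * x) ≡ 1ℤ * (+ 16 * (+ 4 * x))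
      lemma = solve-∀
    ih : ((+ 2) ^ j ∣ a/2 i) × ((+ 2) ^ j ∣ b/2 i)
    ih = 2^∣ j a/2 b/2 F′≡0 i
    lift : ∀ {x} (2∣x : + 2 ∣ x) → (+ 2) ^ j ∣ quotient 2∣x → (+ 2) ^ suc j ∣ x
    lift (divides x/2 refl) 2^j∣x/2 = subst (_ ∣_) (ℤ.*-comm (+ 2) x/2) (*-monoʳ-∣ (+ 2) 2^j∣x/2)

-- Powers of 2 and coherent approximations.

2^ : ℕ → ℤ
2^ n = + (2 ℕ.^ n)

2^-+ : ∀ m n → 2^ (m ℕ.+ n) ≡ 2^ m * 2^ n
2^-+ m n = trans (cong +_ (ℕ.^-distribˡ-+-* 2 m n)) (pos-* (2 ℕ.^ m) (2 ℕ.^ n))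

2^≡ : ∀ n → 2^ n ≡ (+ 2) ^ n
2^≡ zero    = refl
2^≡ (suc n) = trans (pos-* 2 (2 ℕ.^ n)) (cong (λ x → + 2 * x) (2^≡ n))

2^≢0 : ∀ n → NonZero (2^ n)
2^≢0 n = ℕ.m^n≢0 2 n

4*16^≡ : ∀ j → + 4 * (+ 16) ^ j ≡ 2^ (2 ℕ.+ 4 ℕ.* j)
4*16^≡ j = begin
  + 4 * (+ 16) ^ j              ≡⟨ cong (λ x → + 4 * x) (ℤ.^-*-assoc (+ 2) 4 j) ⟩
  + 4 * (+ 2) ^ (4 ℕ.* j)       ≡⟨ cong (λ x → + 4 * x) (2^≡ (4 ℕ.* j)) ⟨
  2^ 2 * 2^ (4 ℕ.* j)           ≡⟨ 2^-+ 2 (4 ℕ.* j) ⟨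
  2^ (2 ℕ.+ 4 ℕ.* j)            ∎
  where open ≡-Reasoning

2^-cancel : ∀ m n {x} → 2^ (m ℕ.+ n) ∣ x * 2^ n → 2^ m ∣ x
2^-cancel m n {x} 2^∣ = *-cancelʳ-∣ (2^ n) {2^ m} {x} ⦃ 2^≢0 n ⦄ (subst (_∣ x * 2^ n) (2^-+ m n) 2^∣)

2^-mono-∣ : ∀ {m n} → m ℕ.≤ n → 2^ m ∣ 2^ n
2^-mono-∣ {m} {n} m≤n =
  divides (2^ (n ℕ.∸ m)) (trans (cong 2^ (sym (ℕ.m∸n+n≡m m≤n))) (2^-+ (n ℕ.∸ m) m))

approx-coherent : ∀ x m t → approx x (t ℕ.+ m) ≡ approx x m mod2^ m
approx-coherent x m zero    = mod-refl (approx x m) m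
approx-coherent x m (suc t) =
  subst (2^ m ∣_) (lemma (approx x (suc (t ℕ.+ m))) (approx x (t ℕ.+ m)) (approx x m))
    (∣m∣n⇒∣m+n (∣-trans (2^-mono-∣ (ℕ.m≤n+m m t)) (coherent x (t ℕ.+ m))) (approx-coherent x m t))
  where
  lemma : ∀ a b c → (a - b) + (b - c) ≡ a - c
  lemma = solve-∀

-- Brings a divisibility found at a finer approximation back to level m, by coherence.
∣approx : ∀ x {m n} → m ℕ.≤ n → 2^ m ∣ approx x n → 2^ m ∣ approx x m
∣approx x {m} {n} m≤n 2^m∣ = subst (2^ m ∣_) (lemma (approx x n) (approx x m))
  (∣m∣n⇒∣m-n 2^m∣ (subst (λ o → approx x o ≡ approx x m mod2^ m) (ℕ.m∸n+n≡m m≤n)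
    (approx-coherent x m (n ℕ.∸ m))))
  where
  lemma : ∀ a b → a - (a - b) ≡ b
  lemma = solve-∀

-- Vanishing and integer representatives in ℚ₂.

module ℚ₂-ring = RawRing ℚ₂-rawRing

≈0⇒∣approx : ∀ x → x ℚ₂-ring.≈ ℚ₂-ring.0# → ∀ n → 2^ n ∣ approx (num x) n
≈0⇒∣approx x x≈0 n = subst (2^ n ∣_) (lemma (approx (num x) n) (2^ (exp x))) (x≈0 n)
  where
  lemma : ∀ a p → a * 1ℤ - 0ℤ * p ≡ a
  lemma = solve-∀

∣approx⇒≈0 : ∀ x → (∀ n → 2^ n ∣ approx (num x) n) → x ℚ₂-ring.≈ ℚ₂-ring.0#
∣approx⇒≈0 x 2^∣ n = subst (2^ n ∣_) (lemma (approx (num x) n) (2^ (exp x))) (2^∣ n)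
  where
  lemma : ∀ a p → a ≡ a * 1ℤ - 0ℤ * p
  lemma = solve-∀

-- The n-th approximation of x, as an element of ℤ[1/2], is a / 2^E.  This is an
-- exact equality, compatible with the ring operations.
record Represents (n E : ℕ) (x : ℚ₂) (a : ℤ) : Set where
  constructor rep
  field equation : approx (num x) n * 2^ E ≡ a * 2^ (exp x)

module _ {n : ℕ} where

  Represents-fromℤ : ∀ a → Represents n 0 (ℚ₂-fromℤ a) a
  Represents-fromℤ a = rep refl

  Represents-+ : ∀ {E x y a b} → Represents n E x a → Represents n E y b →
    Represents n E (x ℚ₂-ring.+ y) (a + b)
  Represents-+ {E} {x} {y} {a} {b} (rep p) (rep q) = rep (begin
    (X * Y′ + Y * X′) * 2^ E           ≡⟨ expand X Y X′ Y′ (2^ E) ⟩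
    (X * 2^ E) * Y′ + (Y * 2^ E) * X′  ≡⟨ cong₂ (λ s t → s * Y′ + t * X′) p q ⟩
    (a * X′) * Y′ + (b * Y′) * X′      ≡⟨ collect a b X′ Y′ ⟩
    (a + b) * (X′ * Y′)                ≡⟨ cong (λ t → (a + b) * t) (2^-+ (exp x) (exp y)) ⟨
    (a + b) * 2^ (exp x ℕ.+ exp y)     ∎)
    where
    open ≡-Reasoning
    X Y X′ Y′ : ℤ
    X = approx (num x) n
    Y = approx (num y) n
    X′ = 2^ (exp x)
    Y′ = 2^ (exp y)
    expand : ∀ X Y X′ Y′ e → (X * Y′ + Y * X′) * e ≡ (X * e) * Y′ + (Y * e) * X′
    expand = solve-∀
    collect : ∀ a b X′ Y′ → (a * X′) * Y′ + (b * Y′) * X′ ≡ (a + b) * (X′ * Y′)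
    collect = solve-∀

  Represents-* : ∀ {E E′ x y a b} → Represents n E x a → Represents n E′ y b →
    Represents n (E ℕ.+ E′) (x ℚ₂-ring.* y) (a * b)
  Represents-* {E} {E′} {x} {y} {a} {b} (rep p) (rep q) = rep (begin
    X * Y * 2^ (E ℕ.+ E′)              ≡⟨ cong (λ t → X * Y * t) (2^-+ E E′) ⟩
    X * Y * (2^ E * 2^ E′)             ≡⟨ interchange X Y (2^ E) (2^ E′) ⟩
    (X * 2^ E) * (Y * 2^ E′)           ≡⟨ cong₂ _*_ p q ⟩
    (a * X′) * (b * Y′)                ≡⟨ interchange a b X′ Y′ ⟨
    a * b * (X′ * Y′)                  ≡⟨ cong (λ t → a * b * t) (2^-+ (exp x) (exp y)) ⟨
    a * b * 2^ (exp x ℕ.+ exp y)       ∎)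
    where
    open ≡-Reasoning
    X Y X′ Y′ : ℤ
    X = approx (num x) n
    Y = approx (num y) n
    X′ = 2^ (exp x)
    Y′ = 2^ (exp y)
    interchange : ∀ a b c d → a * b * (c * d) ≡ (a * c) * (b * d)
    interchange = solve-∀

  Represents-scale : ∀ {E} x → exp x ℕ.≤ E →
    Represents n E x (approx (num x) n * 2^ (E ℕ.∸ exp x))
  Represents-scale {E} x exp≤E = rep (begin
    X * 2^ E                                     ≡⟨ cong (λ e → X * 2^ e) (ℕ.m∸n+n≡m exp≤E) ⟨
    X * 2^ (E ℕ.∸ exp x ℕ.+ exp x)               ≡⟨ cong (λ t → X * t) (2^-+ (E ℕ.∸ exp x) (exp x)) ⟩
    X * (2^ (E ℕ.∸ exp x) * 2^ (exp x))          ≡⟨ ℤ.*-assoc X (2^ (E ℕ.∸ exp x)) (2^ (exp x)) ⟨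
    X * 2^ (E ℕ.∸ exp x) * 2^ (exp x)            ∎)
    where
    open ≡-Reasoning
    X : ℤ
    X = approx (num x) n

  -- The surplus E in the exponent pays for cancelling the common denominator.
  Represents-∣approx : ∀ {m E x a} → Represents n E x a → 2^ (m ℕ.+ E) ∣ a → 2^ m ∣ approx (num x) n
  Represents-∣approx {m} {E} {x} (rep p) 2^∣a =
    2^-cancel m E (subst (2^ (m ℕ.+ E) ∣_) (sym p) (∣m⇒∣m*n (2^ (exp x)) 2^∣a))

  Represents-∣ : ∀ {m E x a} → Represents n E x a → 2^ (m ℕ.+ exp x) ∣ approx (num x) n → 2^ m ∣ a
  Represents-∣ {m} {E} {x} {a} (rep p) 2^∣ =
    2^-cancel m (exp x) (subst (2^ (m ℕ.+ exp x) ∣_) p (∣m⇒∣m*n (2^ E) 2^∣))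

-- Supplies one denominator for all coordinates of a vector.
bounded : ∀ {n} (f : Fin n → ℕ) → ∃[ m ] ∀ i → f i ℕ.≤ m
bounded {zero}  f = 0 , λ ()
bounded {suc n} f =
  let m , f≤m = bounded (f ∘ suc)
  in  f zero ℕ.⊔ m , λ { zero    → ℕ.m≤m⊔n (f zero) m
                       ; (suc i) → ℕ.≤-trans (f≤m i) (ℕ.m≤n⊔m (f zero) m) }

-- Rep E x a b reads: x is represented by a / 2^E + (b / 2^E) √d.  The ring K is kept
-- abstract because comparing powers in ℚ₂⟨√ d ⟩ definitionally is prohibitively slow.
record Representation (K : RawRing 0ℓ 0ℓ) (d : ℤ) : Set₁ where
  open RawRing K using (Carrier; 1#) renaming (_+_ to _+ᴷ_; _*_ to _*ᴷ_)
  field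
    Rep   : ℕ → Carrier → ℤ → ℤ → Set
    rep-1 : Rep 0 1# 1ℤ 0ℤ
    rep-+ : ∀ {E x y a b a′ b′} → Rep E x a b → Rep E y a′ b′ → Rep E (x +ᴷ y) (a + a′) (b + b′)
    rep-* : ∀ {E E′ x y a b a′ b′} → Rep E x a b → Rep E′ y a′ b′ →
      Rep (E ℕ.+ E′) (x *ᴷ y) (a * a′ + d * (b * b′)) (a * b′ + b * a′)

-- Evaluation of the forms on represented vectors.

module RepresentedForms (K : RawRing 0ℓ 0ℓ) (d : ℤ) (representation : Representation K d) where

  open Representation representation
  module K = RawRing K
  open Forms K using (G; H; G+_·H)
  open RawSemiringDefs K.rawSemiring using () renaming (_^_ to _^ᴷ_)

  -- The components of the product enter through equations, so that each stage of the fourth power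
  -- can be simplified before the next multiplication.
  rep-^-suc : ∀ {E x a b} m {a′ b′ a″ b″} → Rep E x a b → Rep (m ℕ.* E) (x ^ᴷ m) a′ b′ →
    a * a′ + d * (b * b′) ≡ a″ → a * b′ + b * a′ ≡ b″ → Rep (suc m ℕ.* E) (x ^ᴷ suc m) a″ b″
  rep-^-suc m r r′ refl refl = rep-* r r′

  rep-^4 : ∀ {E x a b} → Rep E x a b → Rep (4 ℕ.* E) (x ^ᴷ 4) (re⁴ d a b) (im⁴ d a b)
  rep-^4 {E} {x} {a} {b} r =
    rep-^-suc 3 r
      (rep-^-suc 2 r
        (rep-^-suc 1 r (rep-^-suc 0 r rep-1 (re₁ d a b) (im₁ a b)) refl (im₂ a b))
        refl refl)
      (re₄ d a b) (im₄ d a b)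
    where
    re₁ : ∀ d a b → a * 1ℤ + d * (b * 0ℤ) ≡ a
    re₁ = solve-∀
    im₁ : ∀ a b → a * 0ℤ + b * 1ℤ ≡ b
    im₁ = solve-∀
    im₂ : ∀ a b → a * b + b * a ≡ + 2 * (a * b)
    im₂ = solve-∀
    re₄ : ∀ d a b → let a₂ = a * a + d * (b * b) ; b₂ = + 2 * (a * b) in
      a * (a * a₂ + d * (b * b₂)) + d * (b * (a * b₂ + b * a₂)) ≡
      a * a * (a * a) + + 6 * d * (a * a) * (b * b) + d * d * (b * b * (b * b))
    re₄ = solve-∀
    im₄ : ∀ d a b → let a₂ = a * a + d * (b * b) ; b₂ = + 2 * (a * b) in
      a * (a * b₂ + b * a₂) + b * (a * a₂ + d * (b * b₂)) ≡
      + 4 * (a * b * (a * a + d * (b * b)))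
    im₄ = solve-∀

  module _ {E} (x : Vector K.Carrier 10) (a b : Vector ℤ 10) (r : ∀ i → Rep E (x i) (a i) (b i)) where

    p q : Vector ℤ 10
    p i = re⁴ d (a i) (b i)
    q i = im⁴ d (a i) (b i)

    rep⁴ : ∀ i → Rep (4 ℕ.* E) (x i ^ᴷ 4) (p i) (q i)
    rep⁴ i = rep-^4 (r i)

    rep-G : Rep (4 ℕ.* E) (G x) (ΣG p) (ΣG q)
    rep-G = subst₂ (Rep (4 ℕ.* E) (G x)) (assoc p) (assoc q)
      (rep-+ (rep-+ (rep-+ (rep⁴ (# 0)) (rep⁴ (# 1))) (rep⁴ (# 2))) (rep⁴ (# 3)))
      where
      lemma : ∀ s t u v → s + t + u + v ≡ s + (t + (u + (v + 0ℤ)))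
      lemma = solve-∀
      assoc : ∀ f → f (# 0) + f (# 1) + f (# 2) + f (# 3) ≡ ΣG f
      assoc f = lemma (f (# 0)) (f (# 1)) (f (# 2)) (f (# 3))

    rep-H : Rep (4 ℕ.* E) (H x) (ΣH p) (ΣH q)
    rep-H = subst₂ (Rep (4 ℕ.* E) (H x)) (assoc p) (assoc q)
      (rep-+ (rep-+ (rep-+ (rep-+ (rep-+
        (rep⁴ (# 4)) (rep⁴ (# 5))) (rep⁴ (# 6))) (rep⁴ (# 7))) (rep⁴ (# 8))) (rep⁴ (# 9)))
      where
      lemma : ∀ s t u v w z → s + t + u + v + w + z ≡ s + (t + (u + (v + (w + (z + 0ℤ)))))
      lemma = solve-∀
      assoc : ∀ f → f (# 4) + f (# 5) + f (# 6) + f (# 7) + f (# 8) + f (# 9) ≡ ΣH f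
      assoc f = lemma (f (# 4)) (f (# 5)) (f (# 6)) (f (# 7)) (f (# 8)) (f (# 9))

    rep-F : ∀ {c u v} → Rep 0 c u v → Rep (4 ℕ.* E) ((G+ c ·H) x)
      (ΣG p + (u * ΣH p + d * (v * ΣH q))) (ΣG q + (u * ΣH q + v * ΣH p))
    rep-F rc = rep-+ rep-G (rep-* rc rep-H)

-- From integer congruences to zeros over the quadratic field.

module Transfer (ε k : ℤ) where
  open Anisotropic ε k
  open Forms ℚ₂⟨√ d ⟩-rawRing using (G+_·H; HasNoNontrivialZero)
  module K = RawRing ℚ₂⟨√ d ⟩-rawRing

  record Representsᴷ (n E : ℕ) (x : K.Carrier) (a b : ℤ) : Set where
    constructor _,_
    field
      rat-rep  : Represents n E (rat x) a
      surd-rep : Represents n E (surd x) b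
  open Representsᴷ

  module _ {n : ℕ} where

    Representsᴷ-+ : ∀ {E x y a b a′ b′} → Representsᴷ n E x a b → Representsᴷ n E y a′ b′ →
      Representsᴷ n E (x K.+ y) (a + a′) (b + b′)
    Representsᴷ-+ {E} {x} {y} {a} {b} {a′} {b′} (p , q) (p′ , q′) =
        Represents-+ {x = rat x} {rat y} {a} {a′} p p′
      , Represents-+ {x = surd x} {surd y} {b} {b′} q q′

    Representsᴷ-* : ∀ {E E′ x y a b a′ b′} → Representsᴷ n E x a b → Representsᴷ n E′ y a′ b′ →
      Representsᴷ n (E ℕ.+ E′) (x K.* y) (a * a′ + d * (b * b′)) (a * b′ + b * a′)
    Representsᴷ-* {x = x} {y} {a} {b} {a′} {b′} (p , q) (p′ , q′) =
        Represents-+ {x = rat x ℚ₂-ring.* rat y} {ℚ₂-fromℤ d ℚ₂-ring.* (surd x ℚ₂-ring.* surd y)}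
          {a * a′} {d * (b * b′)}
          (Represents-* {x = rat x} {rat y} {a} {a′} p p′)
          (Represents-* {x = ℚ₂-fromℤ d} {surd x ℚ₂-ring.* surd y} {d} {b * b′} (Represents-fromℤ {n} d)
            (Represents-* {x = surd x} {surd y} {b} {b′} q q′))
      , Represents-+ {x = rat x ℚ₂-ring.* surd y} {surd x ℚ₂-ring.* rat y} {a * b′} {b * a′}
          (Represents-* {x = rat x} {surd y} {a} {b′} p q′)
          (Represents-* {x = surd x} {rat y} {b} {a′} q p′)

    Representsᴷ-1 : Representsᴷ n 0 K.1# 1ℤ 0ℤ
    Representsᴷ-1 = Represents-fromℤ 1ℤ , Represents-fromℤ 0ℤ

    representation : Representation ℚ₂⟨√ d ⟩-rawRing d
    representation = record
      { Rep   = Representsᴷ n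
      ; rep-1 = Representsᴷ-1
      ; rep-+ = λ {E} {x} {y} {a} {b} {a′} {b′} → Representsᴷ-+ {E} {x} {y} {a} {b} {a′} {b′}
      ; rep-* = λ {E} {E′} {x} {y} {a} {b} {a′} {b′} →
                  Representsᴷ-* {E} {E′} {x} {y} {a} {b} {a′} {b′}
      }

    open RepresentedForms ℚ₂⟨√ d ⟩-rawRing d representation using (rep-F)

    Representsᴷ-F : ∀ {E c} (x : Vector K.Carrier 10) (a b : Vector ℤ 10) →
      (∀ i → Representsᴷ n E (x i) (a i) (b i)) → Representsᴷ n 0 c (ε * d) 1ℤ →
      Representsᴷ n (4 ℕ.* E) ((G+ c ·H) x) (reF (re⁴ⱽ a b) (im⁴ⱽ a b)) (imF (re⁴ⱽ a b) (im⁴ⱽ a b))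
    -- The coefficient of √d in c is 1; `reF` omits this factor in front of the imaginary sum over
    -- H, while `rep-F` produces it.
    Representsᴷ-F {E} {c} x a b r rc = subst (λ t → Representsᴷ n (4 ℕ.* E) ((G+ c ·H) x)
        (ΣG (re⁴ⱽ a b) + (ε * d * ΣH (re⁴ⱽ a b) + d * t)) (imF (re⁴ⱽ a b) (im⁴ⱽ a b)))
      (ℤ.*-identityˡ (ΣH (im⁴ⱽ a b)))
      (rep-F {E} x a b r {c} {ε * d} {1ℤ} rc)

  -- The representatives depend on the level n, so divisibility by 2^m is asserted at one
  -- sufficiently fine level. The denominators of y are absorbed by choosing n beyond m by both
  -- exponents.
  ≈0⇒∣ : ∀ {E} (y : K.Carrier) (u v : ℕ → ℤ) → (∀ n → Representsᴷ n E y (u n) (v n)) →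
    y K.≈ K.0# → ∀ m → ∃[ n ] (m ℕ.≤ n) × (2^ m ∣ u n) × (2^ m ∣ v n)
  ≈0⇒∣ y u v r (rat≈0 , surd≈0) m = n , ℕ.m≤m+n m _
    , Represents-∣ {m = m} {x = rat y} {u n} (rat-rep (r n))
        (∣-trans (2^-mono-∣ (ℕ.+-monoʳ-≤ m (ℕ.m≤m+n (exp (rat y)) (exp (surd y)))))
          (≈0⇒∣approx (rat y) rat≈0 n))
    , Represents-∣ {m = m} {x = surd y} {v n} (surd-rep (r n))
        (∣-trans (2^-mono-∣ (ℕ.+-monoʳ-≤ m (ℕ.m≤n+m (exp (surd y)) (exp (rat y)))))
          (≈0⇒∣approx (surd y) surd≈0 n))
    where
    n : ℕ
    n = m ℕ.+ (exp (rat y) ℕ.+ exp (surd y))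

  noNontrivialZero : ∀ c → (∀ n → Represents n 0 (rat c) (ε * d)) → (∀ n → Represents n 0 (surd c) 1ℤ) →
    HasNoNontrivialZero (G+ c ·H)
  noNontrivialZero c rat-c surd-c (x , F≈0 , x≉0) = x≉0 (λ i →
    ∣approx⇒≈0 (rat (x i)) (λ m → proj₁ (2^∣x m i)) , ∣approx⇒≈0 (surd (x i)) (λ m → proj₂ (2^∣x m i)))
    where
    bound : ∃[ E ] ∀ i → exp (rat (x i)) ℕ.+ exp (surd (x i)) ℕ.≤ E
    bound = bounded (λ i → exp (rat (x i)) ℕ.+ exp (surd (x i)))
    E : ℕ
    E = proj₁ bound
    a b : ℕ → Vector ℤ 10
    a n i = approx (num (rat (x i))) n * 2^ (E ℕ.∸ exp (rat (x i)))
    b n i = approx (num (surd (x i))) n * 2^ (E ℕ.∸ exp (surd (x i)))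
    r : ∀ n i → Representsᴷ n E (x i) (a n i) (b n i)
    r n i = Represents-scale (rat (x i)) (ℕ.m+n≤o⇒m≤o (exp (rat (x i))) (proj₂ bound i))
          , Represents-scale (surd (x i)) (ℕ.m+n≤o⇒n≤o (exp (rat (x i))) (proj₂ bound i))
    reFₙ imFₙ : ℕ → ℤ
    reFₙ n = reF (re⁴ⱽ (a n) (b n)) (im⁴ⱽ (a n) (b n))
    imFₙ n = imF (re⁴ⱽ (a n) (b n)) (im⁴ⱽ (a n) (b n))
    F-vanishes : ∀ m → ∃[ n ] (m ℕ.≤ n) × (2^ m ∣ reFₙ n) × (2^ m ∣ imFₙ n)
    F-vanishes = ≈0⇒∣ ((G+ c ·H) x) reFₙ imFₙ
      (λ n → Representsᴷ-F {n} {E} {c} x (a n) (b n) (r n) (rat-c n , surd-c n)) F≈0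
    2^∣x : ∀ m i → (2^ m ∣ approx (num (rat (x i))) m) × (2^ m ∣ approx (num (surd (x i))) m)
    2^∣x m i =
        ∣approx (num (rat (x i))) m≤n (Represents-∣approx {m = m} {x = rat (x i)} {a n i} (rat-rep (r n i))
          (subst (_∣ a n i) (sym (2^≡ j)) (proj₁ 2^∣ab)))
      , ∣approx (num (surd (x i))) m≤n (Represents-∣approx {m = m} {x = surd (x i)} {b n i} (surd-rep (r n i))
          (subst (_∣ b n i) (sym (2^≡ j)) (proj₂ 2^∣ab)))
      where
      j M n : ℕ
      -- The descent needs the modulus 4 · 16^j = 2^(2 + 4j) to give 2^j, of which 2^E is lost to
      -- the common denominator and 2^m remains.
      j = m ℕ.+ E
      M = 2 ℕ.+ 4 ℕ.* j
      vanishing : ∃[ n ] (M ℕ.≤ n) × (2^ M ∣ reFₙ n) × (2^ M ∣ imFₙ n)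
      vanishing = F-vanishes M
      n = proj₁ vanishing
      m≤n : m ℕ.≤ n
      m≤n = ℕ.≤-trans (ℕ.m≤n⇒m≤o+n 2 (ℕ.≤-trans (ℕ.m≤m+n m E) (ℕ.m≤m+n j (3 ℕ.* j))))
              (proj₁ (proj₂ vanishing))
      2^∣ab : ((+ 2) ^ j ∣ a n i) × ((+ 2) ^ j ∣ b n i)
      2^∣ab = 2^∣ j (a n) (b n)
        (subst (λ q → ZeroMod q (a n) (b n)) (sym (4*16^≡ j))
          (proj₁ (proj₂ (proj₂ vanishing)) , proj₂ (proj₂ (proj₂ vanishing)))) i

-- The four fields.

noNontrivialZeroOver : ∀ ε k δ → δ ≡ Anisotropic.d ε k → (c : ℚ₂⟨√ δ ⟩) →
  (∀ n → Represents n 0 (rat c) (ε * δ)) → (∀ n → Represents n 0 (surd c) 1ℤ) →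
  NoNontrivialZeroOver δ (Forms.G+_·H ℚ₂⟨√ δ ⟩-rawRing c)
noNontrivialZeroOver ε k δ refl = Transfer.noNontrivialZero ε k

mainTheorem2 : NoNontrivialZeroOver (+ 2) (G+πH (+ 2))
    × NoNontrivialZeroOver (+ 10) (G+πH (+ 10))
    × NoNontrivialZeroOver (- (+ 2)) (G+[π+π²]H (- (+ 2)))
    × NoNontrivialZeroOver (- (+ 10)) (G+[π+π²]H (- (+ 10)))
mainTheorem2 =
    -- The values of k solve d = 2(1 + 2ε + 4k). The coefficient of H is εd + √d: π for ε = 0, and π
    -- + π² for ε = 1 since π² = d.
    noNontrivialZeroOver 0ℤ 0ℤ (+ 2) refl (√ (+ 2)) (λ _ → rep refl) (λ _ → rep refl)
  , noNontrivialZeroOver 0ℤ 1ℤ (+ 10) refl (√ (+ 10)) (λ _ → rep refl) (λ _ → rep refl)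
  , noNontrivialZeroOver 1ℤ (- (+ 1)) (- (+ 2)) refl (π+π² (- (+ 2))) (λ _ → rep refl) (λ _ → rep refl)
  , noNontrivialZeroOver 1ℤ (- (+ 2)) (- (+ 10)) refl (π+π² (- (+ 10))) (λ _ → rep refl) (λ _ → rep refl)
  where
  π+π² : ∀ d → ℚ₂⟨√ d ⟩
  π+π² d = √ d K.+ √ d ^ᴷ 2
    where
    module K = RawRing ℚ₂⟨√ d ⟩-rawRing
    open RawSemiringDefs K.rawSemiring using () renaming (_^_ to _^ᴷ_)
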